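{- The unimodal spi-logic $\mathsf{SPi}_{lin}=\mathsf{SPi}+\{p\to\Diamond p,\ \Diamond\Diamond p\to\Diamond p,\ \Diamond(p\wedge q)\wedge\Diamond(p\wedge r)\to\Diamond(p\wedge\Diamond q\wedge\Diamond r)\}$ is complete.
   Context: Unimodal setting: one diamond $\Diamond$. Sp-formulas: built from propositional variables and $\top$ by $\wedge$ and $\Diamond$; sp-implications $\sigma\to\tau$. A SLO is an algebra $(A,\wedge,\top,\Diamond)$ with $(A,\wedge,\top)$ a meet-semilattice with top and $\Diamond$ monotone; it validates $\sigma\to\tau$ if $\sigma[\mathfrak a]\le\tau[\mathfrak a]$ for all valuations. Frames $(W,R)$ with standard Kripke semantics. $\Sigma\models_{\mathsf{Kr}}\iota$ (resp. $\models_{\mathsf{SLO}}$): valid in every frame (resp. SLO) validating $\Sigma$. $\mathsf{SPi}+\Sigma=\{\iota\mid\Sigma\models_{\mathsf{SLO}}\iota\}$ is complete if $\Sigma\models_{\mathsf{Kr}}\iota\iff\Sigma\models_{\mathsf{SLO}}\iota$ for every sp-implication $\iota$. (The frames validating the three axioms are exactly the linear quasiorders.) -}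

module Defs where

open import Data.Nat.Base using (ℕ)
open import Data.Product.Base using (∃; _×_)
open import Data.Unit.Polymorphic.Base using (⊤)
open import Function.Bundles using (_⇔_)
open import Level using (Level; 0ℓ; _⊔_) renaming (suc to lsuc)
open import Relation.Binary.Core using (Rel; _Preserves_⟶_)
open import Relation.Binary.Lattice.Bundles using (BoundedMeetSemilattice)
open import Relation.Unary using (Pred; ｛_｝; _∪_; _∈_)

infix  9 ◆_
infixr 7 _∧′_
infix  5 _⇒_

data Formula : Set where
  var  : ℕ → Formula
  ⊤′   : Formula
  _∧′_ : Formula → Formula → Formula
  ◆_   : Formula → Formula

record Implication : Set where
  constructor _⇒_
  field
    antecedent : Formula
    consequent : Formula

-- Congruence of ◇ for _≈_ follows from monotonicity and antisymmetry.
record SLO c ℓ₁ ℓ₂ : Set (lsuc (c ⊔ ℓ₁ ⊔ ℓ₂)) where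
  field
    boundedMeetSemilattice : BoundedMeetSemilattice c ℓ₁ ℓ₂

  open BoundedMeetSemilattice boundedMeetSemilattice public
    renaming (⊤ to top)

  field
    ◇      : Carrier → Carrier
    ◇-mono : ◇ Preserves _≤_ ⟶ _≤_

module _ {c ℓ₁ ℓ₂} (A : SLO c ℓ₁ ℓ₂) where
  open SLO A

  ⟦_⟧ : Formula → (ℕ → Carrier) → Carrier
  ⟦ var i  ⟧ 𝔞 = 𝔞 i
  ⟦ ⊤′     ⟧ 𝔞 = top
  ⟦ φ ∧′ ψ ⟧ 𝔞 = ⟦ φ ⟧ 𝔞 ∧ ⟦ ψ ⟧ 𝔞
  ⟦ ◆ φ    ⟧ 𝔞 = ◇ (⟦ φ ⟧ 𝔞)

  ValidSLO : Pred Implication (c ⊔ ℓ₂)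
  ValidSLO (σ ⇒ τ) = ∀ (𝔞 : ℕ → Carrier) → ⟦ σ ⟧ 𝔞 ≤ ⟦ τ ⟧ 𝔞

-- W may be empty: an empty frame validates every implication, so allowing it
-- does not affect Kripke consequence.
record Frame a : Set (lsuc a) where
  field
    W : Set a
    R : Rel W a

module _ {a} (F : Frame a) where
  open Frame F

  Holds : (ℕ → Pred W a) → W → Formula → Set a
  Holds V x (var i)  = x ∈ V i
  Holds V x ⊤′       = ⊤
  Holds V x (φ ∧′ ψ) = Holds V x φ × Holds V x ψ
  Holds V x (◆ φ)    = ∃ λ y → R x y × Holds V y φ

  ValidKr : Pred Implication (lsuc a)
  ValidKr (σ ⇒ τ) = ∀ (V : ℕ → Pred W a) (x : W) → Holds V x σ → Holds V x τ

-- Consequence is relative to the universe levels of the frames, respectively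
-- SLOs, quantified over.
Kr-Consequence : ∀ a → Pred Implication 0ℓ → Pred Implication (lsuc a)
Kr-Consequence a Σ ι =
  ∀ (F : Frame a) → (∀ κ → κ ∈ Σ → ValidKr F κ) → ValidKr F ι

SLO-Consequence : ∀ c ℓ₁ ℓ₂ → Pred Implication 0ℓ →
                  Pred Implication (lsuc (c ⊔ ℓ₁ ⊔ ℓ₂))
SLO-Consequence c ℓ₁ ℓ₂ Σ ι =
  ∀ (A : SLO c ℓ₁ ℓ₂) → (∀ κ → κ ∈ Σ → ValidSLO A κ) → ValidSLO A ι

-- Completeness of the spi-logic SPi + Σ.
Complete : ∀ (a c ℓ₁ ℓ₂ : Level) → Pred Implication 0ℓ →
           Set (lsuc (a ⊔ c ⊔ ℓ₁ ⊔ ℓ₂))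
Complete a c ℓ₁ ℓ₂ Σ =
  ∀ ι → Kr-Consequence a Σ ι ⇔ SLO-Consequence c ℓ₁ ℓ₂ Σ ι

reflexivity transitivity linearity : Implication
reflexivity  = p ⇒ ◆ p
  where p = var 0
transitivity = ◆ ◆ p ⇒ ◆ p
  where p = var 0
linearity    = ◆ (p ∧′ q) ∧′ ◆ (p ∧′ r) ⇒ ◆ (p ∧′ ◆ q ∧′ ◆ r)
  where p = var 0 ; q = var 1 ; r = var 2

-- The axioms of SPi_lin.
Lin : Pred Implication 0ℓ
Lin = ｛ reflexivity ｝ ∪ ｛ transitivity ｝ ∪ ｛ linearity ｝

{-# OPTIONS --safe #-}

-- Modulo the axioms every formula is a conjunction of variables and of chains
-- ◇(U₁ ∧ ◇(U₂ ∧ … ◇(Uₘ ∧ ◇⊤))), where each Uₖ is a conjunction of variables: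
-- linearity distributes ◇(U ∧ –) over conjunctions of ◇-formulas.  The chain
-- U₁,…,Uₘ is refuted everywhere in the linear quasiorder whose points are the
-- pairs (k , v) with v ∈ Uₖ, ordered by k, where (k , v) satisfies all variables
-- except v.  A formula σ either holds somewhere in this model or derives the
-- chain: read the chain greedily along the branches of σ, letting the
-- variables of one node absorb several consecutive Uₖ by reflexivity.
module Submission where

open import Data.Empty using (⊥-elim)
open import Data.List.Base using (List; []; _∷_; _++_; map)
open import Data.List.Membership.Propositional using (_∈_; _∉_; find)
open import Data.List.Membership.Propositional.Properties using (∈-++⁺ˡ; ∈-++⁺ʳ; ∈-++⁻; ∈-map⁺; ∈-map⁻)
open import Data.List.Relation.Unary.All as All using ()
open import Data.List.Relation.Unary.All.Properties using (¬All⇒Any¬)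
open import Data.List.Relation.Unary.Any using (here; there)
open import Data.Nat.Base using (ℕ; suc; _≤_; z≤n; s≤s)
open import Data.Nat.Properties using (_≟_; ≤-refl; ≤-trans; ≤-total)
open import Data.List.Membership.DecPropositional _≟_ using (_∈?_)
open import Data.Product.Base using (∃; _×_; _,_)
open import Data.Sum.Base using (_⊎_; inj₁; inj₂)
open import Function.Base using (_∘_)
open import Function.Bundles using (mk⇔)
open import Level using (Level; Lift; lift; lower)
open import Relation.Binary.PropositionalEquality using (_≡_; _≢_; refl; cong; cong₂; subst₂)
open import Relation.Nullary using (¬_; yes; no)
open import Defs

-- Derivability from the three axioms

infix 4 _⊢_

-- The pivot: each consequence relation is compared with derivability, at its own universe levels.
-- The axioms are schematic, so no substitution rule is needed.
data _⊢_ : Formula → Formula → Set where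
  ⊢-refl  : ∀ {φ} → φ ⊢ φ
  ⊢-trans : ∀ {φ ψ χ} → φ ⊢ ψ → ψ ⊢ χ → φ ⊢ χ
  ⊤-intro : ∀ {φ} → φ ⊢ ⊤′
  ∧-elimˡ : ∀ {φ ψ} → φ ∧′ ψ ⊢ φ
  ∧-elimʳ : ∀ {φ ψ} → φ ∧′ ψ ⊢ ψ
  ∧-intro : ∀ {χ φ ψ} → χ ⊢ φ → χ ⊢ ψ → χ ⊢ φ ∧′ ψ
  ◆-mono  : ∀ {φ ψ} → φ ⊢ ψ → ◆ φ ⊢ ◆ ψ
  ◆-refl  : ∀ {φ} → φ ⊢ ◆ φ
  ◆-trans : ∀ {φ} → ◆ ◆ φ ⊢ ◆ φ
  ◆-lin   : ∀ {φ ψ χ} → ◆ (φ ∧′ ψ) ∧′ ◆ (φ ∧′ χ) ⊢ ◆ (φ ∧′ ◆ ψ ∧′ ◆ χ)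

triple : ∀ {a} {A : Set a} → A → A → A → ℕ → A
triple x y z 0             = x
triple x y z 1             = y
triple x y z (suc (suc _)) = z

-- Soundness

module _ {c ℓ₁ ℓ₂} (A : SLO c ℓ₁ ℓ₂) (valid : ∀ κ → Lin κ → ValidSLO A κ) where
  private module A = SLO A

  sound-SLO : ∀ {σ τ} → σ ⊢ τ → ValidSLO A (σ ⇒ τ)
  sound-SLO ⊢-refl        𝔞 = A.refl
  sound-SLO (⊢-trans d e) 𝔞 = A.trans (sound-SLO d 𝔞) (sound-SLO e 𝔞)
  sound-SLO ⊤-intro       𝔞 = A.maximum _
  sound-SLO ∧-elimˡ       𝔞 = A.x∧y≤x _ _
  sound-SLO ∧-elimʳ       𝔞 = A.x∧y≤y _ _
  sound-SLO (∧-intro d e) 𝔞 = A.∧-greatest (sound-SLO d 𝔞) (sound-SLO e 𝔞)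
  sound-SLO (◆-mono d)    𝔞 = A.◇-mono (sound-SLO d 𝔞)
  sound-SLO (◆-refl {φ})  𝔞 = valid reflexivity (inj₁ refl) λ _ → ⟦ A ⟧ φ 𝔞
  sound-SLO (◆-trans {φ}) 𝔞 = valid transitivity (inj₂ (inj₁ refl)) λ _ → ⟦ A ⟧ φ 𝔞
  sound-SLO (◆-lin {φ} {ψ} {χ}) 𝔞 =
    valid linearity (inj₂ (inj₂ refl)) (triple (⟦ A ⟧ φ 𝔞) (⟦ A ⟧ ψ 𝔞) (⟦ A ⟧ χ 𝔞))

module _ {a} (F : Frame a) (valid : ∀ κ → Lin κ → ValidKr F κ) where

  sound-Kr : ∀ {σ τ} → σ ⊢ τ → ValidKr F (σ ⇒ τ)
  sound-Kr ⊢-refl        V x h           = h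
  sound-Kr (⊢-trans d e) V x h           = sound-Kr e V x (sound-Kr d V x h)
  sound-Kr ⊤-intro       V x h           = _
  sound-Kr ∧-elimˡ       V x (h , _)     = h
  sound-Kr ∧-elimʳ       V x (_ , h)     = h
  sound-Kr (∧-intro d e) V x h           = sound-Kr d V x h , sound-Kr e V x h
  sound-Kr (◆-mono d)    V x (y , r , h) = y , r , sound-Kr d V y h
  sound-Kr (◆-refl {φ})  V = valid reflexivity (inj₁ refl) λ _ y → Holds F V y φ
  sound-Kr (◆-trans {φ}) V = valid transitivity (inj₂ (inj₁ refl)) λ _ y → Holds F V y φ
  sound-Kr (◆-lin {φ} {ψ} {χ}) V =
    valid linearity (inj₂ (inj₂ refl)) λ i y → Holds F V y (triple φ ψ χ i)

-- The Lindenbaum–Tarski algebra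

module _ (c ℓ₁ ℓ₂ : Level) where

  -- `Lift` places the algebra of formulas at whichever levels the consequence relation quantifies
  -- over.
  lindenbaum : SLO c ℓ₁ ℓ₂
  lindenbaum = record
    { boundedMeetSemilattice = record
      { Carrier = Lift c Formula
      ; _≈_     = λ φ ψ → Lift ℓ₁ (lower φ ⊢ lower ψ × lower ψ ⊢ lower φ)
      ; _≤_     = λ φ ψ → Lift ℓ₂ (lower φ ⊢ lower ψ)
      ; _∧_     = λ φ ψ → lift (lower φ ∧′ lower ψ)
      ; ⊤       = lift ⊤′
      ; isBoundedMeetSemilattice = record
        { isMeetSemilattice = record
          { isPartialOrder = record
            { isPreorder = record
              { isEquivalence = record
                { refl  = lift (⊢-refl , ⊢-refl)
                ; sym   = λ (lift (d , e)) → lift (e , d)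
                ; trans = λ (lift (d , e)) (lift (d′ , e′)) → lift (⊢-trans d d′ , ⊢-trans e′ e)
                }
              ; reflexive = λ (lift (d , _)) → lift d
              ; trans     = λ (lift d) (lift e) → lift (⊢-trans d e)
              }
            ; antisym = λ (lift d) (lift e) → lift (d , e)
            }
          ; infimum = λ _ _ → lift ∧-elimˡ , lift ∧-elimʳ , λ _ (lift d) (lift e) → lift (∧-intro d e)
          }
        ; maximum = λ _ → lift ⊤-intro
        }
      }
    ; ◇      = λ φ → lift (◆ lower φ)
    ; ◇-mono = λ (lift d) → lift (◆-mono d)
    }

  lindenbaum-Lin : ∀ κ → Lin κ → ValidSLO lindenbaum κ
  lindenbaum-Lin _ (inj₁ refl)        𝔞 = lift ◆-refl
  lindenbaum-Lin _ (inj₂ (inj₁ refl)) 𝔞 = lift ◆-trans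
  lindenbaum-Lin _ (inj₂ (inj₂ refl)) 𝔞 = lift ◆-lin

  lindenbaum-⟦⟧ : ∀ φ → lower (⟦ lindenbaum ⟧ φ (lift ∘ var)) ≡ φ
  lindenbaum-⟦⟧ (var i)  = refl
  lindenbaum-⟦⟧ ⊤′       = refl
  lindenbaum-⟦⟧ (φ ∧′ ψ) = cong₂ _∧′_ (lindenbaum-⟦⟧ φ) (lindenbaum-⟦⟧ ψ)
  lindenbaum-⟦⟧ (◆ φ)    = cong ◆_ (lindenbaum-⟦⟧ φ)

  complete-SLO : ∀ σ τ → SLO-Consequence c ℓ₁ ℓ₂ Lin (σ ⇒ τ) → σ ⊢ τ
  complete-SLO σ τ valid =
    subst₂ _⊢_ (lindenbaum-⟦⟧ σ) (lindenbaum-⟦⟧ τ)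
      (lower (valid lindenbaum lindenbaum-Lin (lift ∘ var)))

-- Chain normal forms

⋀ : ∀ {A : Set} → (A → Formula) → List A → Formula
⋀ f []       = ⊤′
⋀ f (x ∷ xs) = f x ∧′ ⋀ f xs

⋀-elim : ∀ {A : Set} {f : A → Formula} {x xs} → x ∈ xs → ⋀ f xs ⊢ f x
⋀-elim (here refl) = ∧-elimˡ
⋀-elim (there x∈)  = ⊢-trans ∧-elimʳ (⋀-elim x∈)

⋀-intro : ∀ {A : Set} {f : A → Formula} {χ} xs → (∀ {x} → x ∈ xs → χ ⊢ f x) → χ ⊢ ⋀ f xs
⋀-intro []       d = ⊤-intro
⋀-intro (x ∷ xs) d = ∧-intro (d (here refl)) (⋀-intro xs (d ∘ there))

∧-mono : ∀ {φ φ′ ψ ψ′} → φ ⊢ φ′ → ψ ⊢ ψ′ → φ ∧′ ψ ⊢ φ′ ∧′ ψ′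
∧-mono d e = ∧-intro (⊢-trans ∧-elimˡ d) (⊢-trans ∧-elimʳ e)

Chain : Set
Chain = List (List ℕ)

chain : Chain → Formula
chain []      = ⊤′
chain (u ∷ π) = ⋀ var u ∧′ ◆ chain π

vars : Formula → List ℕ
vars (var i)  = i ∷ []
vars ⊤′       = []
vars (φ ∧′ ψ) = vars φ ++ vars ψ
vars (◆ φ)    = []

-- The chain vars φ ∷ [] is added so that ◆ φ has a chain even if φ has none.
chains : Formula → List Chain
chains (var i)  = []
chains ⊤′       = []
chains (φ ∧′ ψ) = chains φ ++ chains ψ
chains (◆ φ)    = map (vars φ ∷_) ([] ∷ chains φ)

vars-elim : ∀ φ {i} → i ∈ vars φ → φ ⊢ var i
vars-elim (var i)  (here refl) = ⊢-refl
vars-elim (φ ∧′ ψ) i∈ with ∈-++⁻ (vars φ) i∈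
... | inj₁ i∈φ = ⊢-trans ∧-elimˡ (vars-elim φ i∈φ)
... | inj₂ i∈ψ = ⊢-trans ∧-elimʳ (vars-elim ψ i∈ψ)

chains-elim : ∀ φ {π} → π ∈ chains φ → φ ⊢ ◆ chain π
chains-elim (φ ∧′ ψ) π∈ with ∈-++⁻ (chains φ) π∈
... | inj₁ π∈φ = ⊢-trans ∧-elimˡ (chains-elim φ π∈φ)
... | inj₂ π∈ψ = ⊢-trans ∧-elimʳ (chains-elim ψ π∈ψ)
chains-elim (◆ φ) π∈ with ∈-map⁻ (vars φ ∷_) π∈
... | _ , here refl , refl =
  -- The chain `vars φ ∷ []` ends in `◆ ⊤′`, which reflexivity supplies.
  ◆-mono (∧-intro (⋀-intro (vars φ) (vars-elim φ)) (⊢-trans ⊤-intro ◆-refl))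
... | _ , there π∈φ , refl =
  ◆-mono (∧-intro (⋀-intro (vars φ) (vars-elim φ)) (chains-elim φ π∈φ))

-- Linearity merges successors satisfying `φ` into a single one, one chain at a time.
◆-collect : ∀ {χ φ} πs → χ ⊢ ◆ φ → (∀ {π} → π ∈ πs → χ ⊢ ◆ (φ ∧′ ◆ chain π)) →
            χ ⊢ ◆ (φ ∧′ ⋀ (◆_ ∘ chain) πs)
◆-collect []       d e = ⊢-trans d (◆-mono (∧-intro ⊢-refl ⊤-intro))
◆-collect (π ∷ πs) d e =
  ⊢-trans (∧-intro (e (here refl)) (◆-collect πs d (e ∘ there)))
    -- Linearity puts an extra `◆` on both merged parts; transitivity removes it, as both are built
    -- from `◆`-formulas.
    (⊢-trans ◆-lin (◆-mono (∧-mono ⊢-refl (∧-mono ◆-trans ◆⋀))))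
  where
  ◆⋀ : ◆ ⋀ (◆_ ∘ chain) πs ⊢ ⋀ (◆_ ∘ chain) πs
  ◆⋀ = ⋀-intro πs λ π∈ → ⊢-trans (◆-mono (⋀-elim π∈)) ◆-trans

-- Converse to `vars-elim` and `chains-elim`. For `◆ φ`, all chains of `φ` are gathered at one
-- successor, where the induction hypothesis applies.
nf-intro : ∀ τ {χ} → (∀ {i} → i ∈ vars τ → χ ⊢ var i) →
           (∀ {π} → π ∈ chains τ → χ ⊢ ◆ chain π) → χ ⊢ τ
nf-intro (var i)  d e = d (here refl)
nf-intro ⊤′       d e = ⊤-intro
nf-intro (φ ∧′ ψ) d e =
  ∧-intro (nf-intro φ (d ∘ ∈-++⁺ˡ) (e ∘ ∈-++⁺ˡ))
          (nf-intro ψ (d ∘ ∈-++⁺ʳ (vars φ)) (e ∘ ∈-++⁺ʳ (chains φ)))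
nf-intro (◆ φ)    d e =
  ⊢-trans
    (◆-collect (chains φ) (⊢-trans (e (here refl)) (◆-mono ∧-elimˡ))
      (e ∘ there ∘ ∈-map⁺ (vars φ ∷_)))
    (◆-mono (nf-intro φ (⊢-trans ∧-elimˡ ∘ ⋀-elim) (⊢-trans ∧-elimʳ ∘ ⋀-elim)))

-- Countermodels

module _ {a : Level} where

  -- Comparing ranks in ℕ gives a linear quasiorder at once; points of equal rank form a cluster.
  ranked : (W : Set a) → (W → ℕ) → Frame a
  ranked W rank = record { W = W ; R = λ x y → Lift a (rank x ≤ rank y) }

  ranked-Lin : ∀ W rank κ → Lin κ → ValidKr (ranked W rank) κ
  ranked-Lin W rank _ (inj₁ refl) V x h = x , lift ≤-refl , h
  ranked-Lin W rank _ (inj₂ (inj₁ refl)) V x (y , lift x≤y , z , lift y≤z , h) =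
    z , lift (≤-trans x≤y y≤z) , h
  ranked-Lin W rank _ (inj₂ (inj₂ refl)) V x ((y , x≤y , p , q) , (z , x≤z , p′ , r))
    with ≤-total (rank y) (rank z)
  ... | inj₁ y≤z = y , x≤y , p , (y , lift ≤-refl , q) , (z , lift y≤z , r)
  ... | inj₂ z≤y = z , x≤z , p′ , (y , lift z≤y , q) , (z , lift ≤-refl , r)

  module _ (v : ℕ) where

    rootFrame : Frame a
    rootFrame = ranked (Lift a ℕ) lower

    -- The variable v fails at the point 0 and nowhere else.
    rootVal : ℕ → Lift a ℕ → Set a
    rootVal i (lift n) = Lift a (n ≡ 0 → v ≢ i)

    rootVal-top : ∀ φ → Holds rootFrame rootVal (lift 1) φ
    rootVal-top (var i)  = lift λ ()
    rootVal-top ⊤′       = _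
    rootVal-top (φ ∧′ ψ) = rootVal-top φ , rootVal-top ψ
    rootVal-top (◆ φ)    = lift 1 , lift ≤-refl , rootVal-top φ

    -- Only `vars φ` constrains the point 0 itself: every `◆` finds its witness at 1, where all
    -- formulas hold.
    rootVal-root : ∀ φ → v ∉ vars φ → Holds rootFrame rootVal (lift 0) φ
    rootVal-root (var i)  v∉ = lift λ _ v≡i → v∉ (here v≡i)
    rootVal-root ⊤′       v∉ = _
    rootVal-root (φ ∧′ ψ) v∉ =
      rootVal-root φ (v∉ ∘ ∈-++⁺ˡ) , rootVal-root ψ (v∉ ∘ ∈-++⁺ʳ (vars φ))
    rootVal-root (◆ φ)    v∉ = lift 1 , lift z≤n , rootVal-top φ

  -- The number of `up`s is the position in the chain, so the model of `π` sits inside that of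
  -- `u ∷ π` above a new bottom cluster.
  data Point : Chain → Set a where
    omit : ∀ {u π} v → v ∈ u → Point (u ∷ π)
    up   : ∀ {u π} → Point π → Point (u ∷ π)

  rank : ∀ {π} → Point π → ℕ
  rank (omit v _) = 0
  rank (up x)     = suc (rank x)

  omitted : ∀ {π} → Point π → ℕ
  omitted (omit v _) = v
  omitted (up x)     = omitted x

  chainFrame : Chain → Frame a
  chainFrame π = ranked (Point π) rank

  _⊩_ : ∀ {π} → Point π → Formula → Set a
  _⊩_ {π} = Holds (chainFrame π) (λ i x → Lift a (omitted x ≢ i))

  -- Whatever `up x` sees has positive rank, hence is again an `up`: the copy of the old model is a
  -- generated subframe, and truth is preserved both ways.
  up⁺ : ∀ {u π} {x : Point π} φ → x ⊩ φ → up {u} x ⊩ φ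
  up⁺ (var i)  h                  = h
  up⁺ ⊤′       h                  = _
  up⁺ (φ ∧′ ψ) (h , k)            = up⁺ φ h , up⁺ ψ k
  up⁺ (◆ φ)    (y , lift x≤y , h) = up y , lift (s≤s x≤y) , up⁺ φ h

  up⁻ : ∀ {u π} {x : Point π} φ → up {u} x ⊩ φ → x ⊩ φ
  up⁻ (var i)  h                           = h
  up⁻ ⊤′       h                           = _
  up⁻ (φ ∧′ ψ) (h , k)                     = up⁻ φ h , up⁻ ψ k
  up⁻ (◆ φ)    (up y , lift (s≤s x≤y) , h) = y , lift x≤y , up⁻ φ h

  ⋀-omitted : ∀ {π} {x : Point π} u → x ⊩ ⋀ var u → omitted x ∉ u
  ⋀-omitted (i ∷ u) (lift x≢i , h) (here x≡i) = x≢i x≡i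
  ⋀-omitted (i ∷ u) (_ , h)        (there x∈) = ⋀-omitted u h x∈

  -- A bottom point lacks a variable of `u`. From a higher point, `◆ chain π` would need a witness
  -- in the copy of the model of `π`.
  chain-refuted : ∀ π (x : Point π) → ¬ x ⊩ chain π
  chain-refuted (u ∷ π) (omit v v∈u) (h , _) = ⋀-omitted u h v∈u
  chain-refuted (u ∷ π) (up x) (_ , h) with up⁻ (◆ chain π) h
  ... | y , _ , k = chain-refuted π y k

  mutual
    derive-or-refute : ∀ σ π → σ ⊢ ◆ chain π ⊎ ∃ λ (x : Point π) → x ⊩ σ
    -- The empty chain has a model without points, but `◆ ⊤′` is always derivable.
    derive-or-refute σ []      = inj₁ (⊢-trans ⊤-intro ◆-refl)
    derive-or-refute σ (u ∷ π) with All.all? (_∈? vars σ) u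
    ... | no u⊈ with find (¬All⇒Any¬ (_∈? vars σ) u u⊈)
    ...   | v , v∈u , v∉σ with derive-or-refute-omit v∈u σ v∉σ
    ...     | inj₁ d = inj₁ d
    ...     | inj₂ h = inj₂ (omit v v∈u , h)
    -- The root of `σ` absorbs `u`, and the same `σ` is read against the rest of the chain.
    derive-or-refute σ (u ∷ π) | yes u⊆ with derive-or-refute σ π
    ... | inj₁ d       = inj₁ (⊢-trans (∧-intro (⋀-intro u (vars-elim σ ∘ All.lookup u⊆)) d) ◆-refl)
    ... | inj₂ (x , h) = inj₂ (up x , up⁺ σ h)

    -- A bottom point sees the whole model, so `◆ φ` holds there once `φ` holds anywhere; otherwise
    -- `φ` derives the full chain under `◆`, and transitivity absorbs the outer `◆`.
    derive-or-refute-omit : ∀ {u π v} (v∈u : v ∈ u) σ → v ∉ vars σ →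
                            σ ⊢ ◆ chain (u ∷ π) ⊎ omit {π = π} v v∈u ⊩ σ
    derive-or-refute-omit v∈u (var i)  v∉ = inj₂ (lift λ v≡i → v∉ (here v≡i))
    derive-or-refute-omit v∈u ⊤′       v∉ = inj₂ _
    derive-or-refute-omit v∈u (φ ∧′ ψ) v∉
      with derive-or-refute-omit v∈u φ (v∉ ∘ ∈-++⁺ˡ)
         | derive-or-refute-omit v∈u ψ (v∉ ∘ ∈-++⁺ʳ (vars φ))
    ... | inj₁ d | _      = inj₁ (⊢-trans ∧-elimˡ d)
    ... | inj₂ _ | inj₁ d = inj₁ (⊢-trans ∧-elimʳ d)
    ... | inj₂ h | inj₂ k = inj₂ (h , k)
    derive-or-refute-omit {u} {π} v∈u (◆ φ) v∉ with derive-or-refute φ (u ∷ π)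
    ... | inj₁ d       = inj₁ (⊢-trans (◆-mono d) ◆-trans)
    ... | inj₂ (x , h) = inj₂ (x , lift z≤n , h)

-- Kripke completeness of the calculus

complete-var : ∀ {a} σ v → Kr-Consequence a Lin (σ ⇒ var v) → σ ⊢ var v
complete-var σ v valid with v ∈? vars σ
... | yes v∈ = vars-elim σ v∈
... | no  v∉ = ⊥-elim
  (lower (valid (rootFrame v) (ranked-Lin _ _) (rootVal v) (lift 0) (rootVal-root v σ v∉)) refl refl)

complete-chain : ∀ {a} σ π → Kr-Consequence a Lin (σ ⇒ ◆ chain π) → σ ⊢ ◆ chain π
complete-chain {a} σ π valid with derive-or-refute {a} σ π
... | inj₁ d = d
... | inj₂ (x , h) with valid (chainFrame π) (ranked-Lin _ _) _ x h
...   | y , _ , k = ⊥-elim (chain-refuted π y k)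

-- By soundness, the variables and chains of `τ` are Kripke consequences too, so countermodels for
-- these two shapes suffice.
complete-Kr : ∀ {a} σ τ → Kr-Consequence a Lin (σ ⇒ τ) → σ ⊢ τ
complete-Kr {a} σ τ valid =
  nf-intro τ (λ {i} i∈ → complete-var σ i (weaken (vars-elim τ i∈)))
             (λ {π} π∈ → complete-chain σ π (weaken (chains-elim τ π∈)))
  where
  weaken : ∀ {ρ} → τ ⊢ ρ → Kr-Consequence a Lin (σ ⇒ ρ)
  weaken d F lin V x h = sound-Kr F lin d V x (valid F lin V x h)

theorem7p12 : ∀ (a c ℓ₁ ℓ₂ : Level) → Complete a c ℓ₁ ℓ₂ Lin
theorem7p12 a c ℓ₁ ℓ₂ (σ ⇒ τ) = mk⇔
  (λ valid A lin → sound-SLO A lin (complete-Kr σ τ valid))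
  (λ valid F lin → sound-Kr F lin (complete-SLO c ℓ₁ ℓ₂ σ τ valid))
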